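{- Let $H$ be an oriented graph with maximum degree $\Delta(H)\le 4$ and directed girth at least $3$ (i.e., every oriented graph of maximum degree at most $4$). Then the arc set $A(H)$ can be partitioned into $3$ feedback arc sets of $H$.
   Context: An oriented graph (orgraph) is a digraph with no loops, no multiple arcs and no directed $2$-cycles. The degree of a vertex is the sum of its in-degree and out-degree; $\Delta(H)$ is the maximum degree. The directed girth is the minimum length of a directed cycle ($\infty$ if there is none). A set $F\subseteq A(H)$ is a feedback arc set if $H-F$ has no directed cycle. -}

module Defs where

open import Data.Nat using (ℕ; zero; suc; _+_; _≤_)
open import Data.Nat.DivMod using (_%_; m%n<n)
open import Data.Fin using (Fin; toℕ; fromℕ<; _≟_)
open import Data.Fin.Properties using (all?)
open import Data.Product using (_×_; _,_; Σ; ∃; proj₁; proj₂)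
open import Data.List using (List; length; filter; allFin)
open import Relation.Binary.PropositionalEquality using (_≡_)
open import Relation.Nullary using (¬_)
open import Function.Definitions using (Injective)

-- An oriented graph on vertex set Fin n with m arcs, the arcs being
-- indexed by Fin m; arc j goes from proj₁ (arc j) to proj₂ (arc j).
record Orgraph (n m : ℕ) : Set where
  field
    arc      : Fin m → Fin n × Fin n
    arc-inj  : Injective _≡_ _≡_ arc
    no-loop  : ∀ j → ¬ (proj₁ (arc j) ≡ proj₂ (arc j))
    no-2cyc  : ∀ j k → ¬ (proj₁ (arc j) ≡ proj₂ (arc k) × proj₂ (arc j) ≡ proj₁ (arc k))
open Orgraph public

outdeg : ∀ {n m} → Orgraph n m → Fin n → ℕ
outdeg H v = length (filter (λ j → proj₁ (arc H j) ≟ v) (allFin _))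

indeg : ∀ {n m} → Orgraph n m → Fin n → ℕ
indeg H v = length (filter (λ j → proj₂ (arc H j) ≟ v) (allFin _))

deg : ∀ {n m} → Orgraph n m → Fin n → ℕ
deg H v = outdeg H v + indeg H v

MaxDegreeAtMost : ∀ {n m} → Orgraph n m → ℕ → Set
MaxDegreeAtMost {n} H d = ∀ (v : Fin n) → deg H v ≤ d

next : ∀ {k} → Fin (suc k) → Fin (suc k)
next {k} i = fromℕ< (m%n<n (suc (toℕ i)) (suc k))

DirectedCycleIn : ∀ {n m} → Orgraph n m → (Fin m → Set) → Set
DirectedCycleIn {n} {m} H S =
  Σ ℕ λ k → Σ (Fin (suc k) → Fin n) λ vs →
    Injective _≡_ _≡_ vs ×
    (∀ i → Σ (Fin m) λ j → S j × arc H j ≡ (vs i , vs (next i)))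

DirectedGirthAtLeast : ∀ {n m} → Orgraph n m → ℕ → Set
DirectedGirthAtLeast {n} {m} H g =
  ∀ k (vs : Fin (suc k) → Fin n) → Injective _≡_ _≡_ vs →
    (∀ i → Σ (Fin m) λ j → arc H j ≡ (vs i , vs (next i))) → g ≤ suc k

FeedbackArcSet : ∀ {n m} → Orgraph n m → (Fin m → Set) → Set
FeedbackArcSet H F = ¬ DirectedCycleIn H (λ j → ¬ F j)

{-# OPTIONS --safe #-}
module Submission where

-- Three rankings of the vertices such that every arc increases strictly in at least two of them give the
-- partition: colour an arc by the ranking in which it fails to increase, and a cycle avoiding one colour would
-- increase forever.  The rankings are built by inserting vertices one at a time; a new vertex v is put first
-- in one ranking, last in a second, and in the third between its in- and out-neighbours present so far.  The
-- third placement needs a ranking that separates these neighbours.  If v has a single out-neighbour x there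
-- (dually, in-neighbour), it is enough to insert x immediately before v: then x is last in some ranking.
-- Removing vertices in the corresponding order never gets stuck, because a vertex that has lost a neighbour
-- has at most three left, hence at most one on one of the two sides.
--
-- This leaves the induced subgraphs in which all vertices have in- and out-degree 2.  If a → m → s and a → s,
-- end with m, a, s in this order.  If there is no such triangle, take a, b → o → c, d and e → d with e ≠ o, and
-- end with e, d, o; here some ranking must have a and b below c before e, d and o are inserted.

open import Defs
open import Data.Nat using (ℕ; zero; suc; _+_; _*_; _≤_; _<_; z≤n; s≤s; s≤s⁻¹; _⊔_)
open import Data.Nat.Properties using
  (≤-refl; ≤-reflexive; ≤-trans; <-≤-trans; ≤-<-trans; <-irrefl; m≤m⊔n; m≤n⊔m; ⊔-lub; m≤n⇒m≤1+n;
   *-monoʳ-≤; *-monoʳ-<; *-suc; +-mono-≤; +-mono-<-≤; +-mono-≤-<; +-comm; _≤?_; ≰⇒>)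
open import Data.Fin using (Fin; zero; suc; _≟_)
open import Data.Fin.Properties using (any?; all?)
open import Data.Fin.Subset using (Subset; _∈_; _∉_; _-_; ∣_∣; _⊆_; ⊤; inside; outside)
open import Data.Fin.Subset.Properties using
  (_∈?_; ∈⊤; p─q⊆p; x∈p∧x≢y⇒x∈p-y; x∈p⇒∣p-x∣<∣p∣; ∣p─q∣≤∣p∣)
open import Data.Vec using ([]; _∷_; here; there)
open import Data.List using (List; []; _∷_; length; filter; map; allFin)
open import Data.List.Properties using (length-map; length-filter)
open import Data.List.Membership.Propositional using () renaming (_∈_ to _∈ˡ_)
open import Data.List.Membership.Propositional.Properties using
  (∈-filter⁺; ∈-filter⁻; ∈-map∘filter⁻; ∈-map∘filter⁺; ∈-allFin)
open import Data.List.Relation.Unary.Any using (here; there)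
import Data.List.Relation.Unary.Any as Any
open import Data.List.Relation.Unary.All using (All; []; _∷_)
import Data.List.Relation.Unary.All as All
open import Data.List.Relation.Unary.AllPairs using ([]; _∷_)
open import Data.List.Relation.Unary.Unique.Propositional using (Unique)
import Data.List.Relation.Unary.Unique.Propositional.Properties as Unique
open import Data.Product using (Σ; _×_; _,_; proj₁; proj₂)
open import Data.Sum using (_⊎_; inj₁; inj₂; swap)
open import Level using (0ℓ)
open import Function using (_∘_; case_of_)
open import Relation.Binary.PropositionalEquality
  using (_≡_; _≢_; refl; sym; trans; cong₂; subst; subst₂)
open import Relation.Nullary using (¬_; Dec; yes; no; ¬?; contradiction)
open import Relation.Nullary.Decidable using (from-yes; _×-dec_; _⊎-dec_; _→-dec_)
open import Relation.Unary using (Pred; Decidable)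

-- Preliminaries on indices, subsets and lists.

abstract

  third : (i k : Fin 3) → Σ (Fin 3) λ j → i ≢ j × k ≢ j
  third i k = from-yes (all? {n = 3} λ i → all? {n = 3} λ k → any? {n = 3} λ j → ¬? (i ≟ j) ×-dec ¬? (k ≟ j)) i k

  exhaust : ∀ (i j k : Fin 3) → i ≢ j → i ≢ k → j ≢ k → ∀ l → l ≡ i ⊎ l ≡ j ⊎ l ≡ k
  exhaust = from-yes (all? {n = 3} λ i → all? {n = 3} λ j → all? {n = 3} λ k →
    ¬? (i ≟ j) →-dec (¬? (i ≟ k) →-dec (¬? (j ≟ k) →-dec
      all? {n = 3} λ l → (l ≟ i) ⊎-dec ((l ≟ j) ⊎-dec (l ≟ k)))))

assign : ∀ {A : Set} {i j k : Fin 3} → i ≢ j → i ≢ k → j ≢ k → (a b c : A) →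
  Σ (Fin 3 → A) λ f → f i ≡ a × f j ≡ b × f k ≡ c
assign {A} {i} {j} {k} i≢j i≢k j≢k a b c = f , fi , fj , fk
  where
  f : Fin 3 → A
  f l with l ≟ i | l ≟ j
  ... | yes _ | _     = a
  ... | no _  | yes _ = b
  ... | no _  | no _  = c
  fi : f i ≡ a
  fi with i ≟ i | i ≟ j
  ... | yes _ | _ = refl
  ... | no ¬p | _ = contradiction refl ¬p
  fj : f j ≡ b
  fj with j ≟ i | j ≟ j
  ... | yes p | _     = contradiction (sym p) i≢j
  ... | no _  | yes _ = refl
  ... | no _  | no ¬p = contradiction refl ¬p
  fk : f k ≡ c
  fk with k ≟ i | k ≟ j
  ... | yes p | _     = contradiction (sym p) i≢k
  ... | no _  | yes p = contradiction (sym p) j≢k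
  ... | no _  | no _  = refl

∈-minus⁻ : ∀ {n} {p : Subset n} {x y} → x ∈ p - y → x ∈ p × x ≢ y
∈-minus⁻ {p = p} {x} {y} x∈ = p─q⊆p p _ x∈ , distinct p x y x∈
  where
  distinct : ∀ {n} (p : Subset n) (x y : Fin n) → x ∈ p - y → x ≢ y
  distinct (outside ∷ p) zero    zero    ()
  distinct (inside  ∷ p) zero    zero    ()
  distinct (_       ∷ p) (suc x) (suc y) (there h) refl = distinct p x y h refl
  distinct (_       ∷ p) zero    (suc y) _ ()
  distinct (_       ∷ p) (suc x) zero    _ ()

leastStrictUpperBound : ∀ {A : Set} (f : A → ℕ) (xs : List A) → Σ ℕ λ θ →
  (∀ {x} → x ∈ˡ xs → f x < θ) × (∀ {b} → (∀ {x} → x ∈ˡ xs → f x < b) → θ ≤ b)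
leastStrictUpperBound f []       = 0 , (λ ()) , λ _ → z≤n
leastStrictUpperBound f (x ∷ xs) with leastStrictUpperBound f xs
... | θ , above , least = suc (f x) ⊔ θ , above′ , λ h → ⊔-lub (h (here refl)) (least (h ∘ there))
  where
  above′ : ∀ {y} → y ∈ˡ x ∷ xs → f y < suc (f x) ⊔ θ
  above′ (here refl) = m≤m⊔n (suc (f x)) θ
  above′ (there y∈)  = ≤-trans (above y∈) (m≤n⊔m (suc (f x)) θ)

module _ {A : Set} {P Q : Pred A 0ℓ} (P? : Decidable P) (Q? : Decidable Q) (P⇒Q : ∀ {x} → P x → Q x) where

  length-filter-mono : ∀ xs → length (filter P? xs) ≤ length (filter Q? xs)
  length-filter-mono []       = z≤n
  length-filter-mono (x ∷ xs) with P? x | Q? x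
  ... | yes p | yes q = s≤s (length-filter-mono xs)
  ... | yes p | no ¬q = contradiction (P⇒Q p) ¬q
  ... | no ¬p | yes q = m≤n⇒m≤1+n (length-filter-mono xs)
  ... | no ¬p | no ¬q = length-filter-mono xs

  length-filter-strict : ∀ {x} xs → x ∈ˡ xs → Q x → ¬ P x → length (filter P? xs) < length (filter Q? xs)
  length-filter-strict (x ∷ xs) (here refl) q ¬p with P? x | Q? x
  ... | yes p | _      = contradiction p ¬p
  ... | no _  | yes _  = s≤s (length-filter-mono xs)
  ... | no _  | no ¬q  = contradiction q ¬q
  length-filter-strict (y ∷ xs) (there x∈) q ¬p with P? y | Q? y
  ... | yes _ | yes _ = s≤s (length-filter-strict xs x∈ q ¬p)
  ... | yes p | no ¬q = contradiction (P⇒Q p) ¬q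
  ... | no _  | yes _ = m≤n⇒m≤1+n (length-filter-strict xs x∈ q ¬p)
  ... | no _  | no _  = length-filter-strict xs x∈ q ¬p

-- Injectivity is asked only on members of the list: a tail determines its arc only among arcs with
-- a common head.
map-unique : ∀ {A B : Set} (f : A → B) {xs} →
  (∀ {x y} → x ∈ˡ xs → y ∈ˡ xs → f x ≡ f y → x ≡ y) → Unique xs → Unique (map f xs)
map-unique f {[]}     inj []       = []
map-unique f {x ∷ xs} inj (x∉ ∷ u) =
  images xs (λ y∈ e → All.lookup x∉ y∈ (inj (here refl) (there y∈) e))
  ∷ map-unique f (λ y∈ z∈ → inj (there y∈) (there z∈)) u
  where
  images : ∀ ys → (∀ {y} → y ∈ˡ ys → f x ≢ f y) → All (f x ≢_) (map f ys)
  images []       h = []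
  images (y ∷ ys) h = h (here refl) ∷ images ys (h ∘ there)

-- Digraphs given by neighbour lists, and good rankings.

record Digraph (n : ℕ) : Set where
  field
    In Out     : Fin n → List (Fin n)
    In⇒Out     : ∀ {u v} → u ∈ˡ In v → v ∈ˡ Out u
    Out⇒In     : ∀ {u v} → v ∈ˡ Out u → u ∈ˡ In v
    asym       : ∀ {u v} → u ∈ˡ In v → ¬ v ∈ˡ In u
    In-unique  : ∀ v → Unique (In v)
    Out-unique : ∀ v → Unique (Out v)
    degree≤4   : ∀ v → length (In v) + length (Out v) ≤ 4

Ranking : ℕ → Set
Ranking n = Fin 3 → Fin n → ℕ

module Construction {n : ℕ} (G : Digraph n) where
  open Digraph G

  infix 4 _⟶_
  _⟶_ : Fin n → Fin n → Set
  u ⟶ v = u ∈ˡ In v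

  irrefl : ∀ {v} → ¬ v ⟶ v
  irrefl e = asym e e

  _⟶?_ : ∀ u v → Dec (u ⟶ v)
  u ⟶? v = Any.any? (u ≟_) (In v)

  ⟶⇒≢ : ∀ {u v} → u ⟶ v → u ≢ v
  ⟶⇒≢ e refl = irrefl e

  Adjacent : Fin n → Fin n → Set
  Adjacent u v = u ⟶ v ⊎ v ⟶ u

  -- The exception `k₀` becomes the colour of the arc. Applied to both orders of a pair, `mixed`
  -- says that each order occurs strictly in some ranking; this supplies a separating ranking when a
  -- vertex has one neighbour on either side.
  record Good (W : Subset n) (r : Ranking n) : Set where
    field
      majority : ∀ {u v} → u ∈ W → v ∈ W → u ⟶ v → Σ (Fin 3) λ k₀ → ∀ k → k ≢ k₀ → r k u < r k v
      mixed    : ∀ {u v} → u ∈ W → v ∈ W → u ≢ v → Σ (Fin 3) λ k → r k u < r k v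
  open Good

  -- Inserting a vertex.

  Separated : Subset n → Fin n → Fin 3 → Ranking n → Set
  Separated U v i r = ∀ {a c} → a ∈ U → c ∈ U → a ⟶ v → v ⟶ c → r i a < r i c

  Prepared : Subset n → Fin n → Set
  Prepared W v = Σ (Ranking n) λ r → Good (W - v) r × Σ (Fin 3) λ i → Separated (W - v) v i r

  First Last : Subset n → Fin n → Fin 3 → Ranking n → Set
  First W v k r = ∀ {x} → x ∈ W → x ≢ v → r k v < r k x
  Last  W v k r = ∀ {x} → x ∈ W → x ≢ v → r k x < r k v

  record Inserted (W : Subset n) (v : Fin n) (φ λ′ : Fin 3) (r : Ranking n) : Set where
    field
      distinct : φ ≢ λ′
      ρ     : Ranking n
      good  : Good W ρ
      first : First W v φ ρ
      last  : Last W v λ′ ρ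
      keep  : ∀ k {x y} → x ≢ v → y ≢ v → r k x < r k y → ρ k x < ρ k y

  -- An arc out of `v` increases in `i` and `φ`, an arc into `v` in `i` and `λ′`. First and last
  -- place also give `mixed` for the pairs containing `v`.
  insert-transparent : ∀ {W v r i φ λ′} → Good (W - v) r → Separated (W - v) v i r →
    i ≢ φ → i ≢ λ′ → φ ≢ λ′ → Inserted W v φ λ′ r
  insert-transparent {W} {v} {r} {i} {φ} {λ′} g sep i≢φ i≢λ φ≢λ = record
    { distinct = φ≢λ
    ; ρ = ρ
    ; good = record { majority = maj ; mixed = mix }
    ; first = fst
    ; last = lst
    ; keep = λ k → old<old
    }
    where
    U = W - v
    -- In `i` the new vertex goes directly above its highest in-neighbour, at the bottom if there is
    -- none; leastness and `sep` then put it below every out-neighbour.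
    cut = leastStrictUpperBound (r i) (filter (_∈? U) (In v))
    top = leastStrictUpperBound (r λ′) (allFin n)
    thresholds = assign i≢φ i≢λ φ≢λ (proj₁ cut) 0 (proj₁ top)
    θ = proj₁ thresholds
    θi = proj₁ (proj₂ thresholds)
    θφ = proj₁ (proj₂ (proj₂ thresholds))
    θλ = proj₂ (proj₂ (proj₂ thresholds))

    -- Doubling leaves an unused even value next to every old rank.
    ρ : Ranking n
    ρ k x with x ≟ v
    ... | yes _ = 2 * θ k
    ... | no  _ = suc (2 * r k x)

    ρ-new : ∀ k → ρ k v ≡ 2 * θ k
    ρ-new k with v ≟ v
    ... | yes _ = refl
    ... | no ¬p = contradiction refl ¬p

    ρ-old : ∀ k {x} → x ≢ v → ρ k x ≡ suc (2 * r k x)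
    ρ-old k {x} x≢v with x ≟ v
    ... | yes p = contradiction p x≢v
    ... | no _  = refl

    old<old : ∀ {k x y} → x ≢ v → y ≢ v → r k x < r k y → ρ k x < ρ k y
    old<old {k} x≢v y≢v lt = subst₂ _<_ (sym (ρ-old k x≢v)) (sym (ρ-old k y≢v)) (s≤s (*-monoʳ-< 2 lt))

    old<new : ∀ {k x} → x ≢ v → r k x < θ k → ρ k x < ρ k v
    old<new {k} {x} x≢v lt = subst₂ _<_ (sym (ρ-old k x≢v)) (sym (ρ-new k))
      (≤-trans (≤-reflexive (sym (*-suc 2 (r k x)))) (*-monoʳ-≤ 2 lt))

    new<old : ∀ {k x} → x ≢ v → θ k ≤ r k x → ρ k v < ρ k x
    new<old {k} x≢v le = subst₂ _<_ (sym (ρ-new k)) (sym (ρ-old k x≢v)) (s≤s (*-monoʳ-≤ 2 le))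

    fst : First W v φ ρ
    fst _ x≢v = new<old x≢v (≤-trans (≤-reflexive θφ) z≤n)

    lst : Last W v λ′ ρ
    lst {x} _ x≢v = old<new x≢v (<-≤-trans (proj₁ (proj₂ top) (∈-allFin x)) (≤-reflexive (sym θλ)))

    in<new : ∀ {a} → a ∈ U → a ⟶ v → ρ i a < ρ i v
    in<new a∈ e = old<new (proj₂ (∈-minus⁻ a∈))
      (<-≤-trans (proj₁ (proj₂ cut) (∈-filter⁺ (_∈? U) e a∈)) (≤-reflexive (sym θi)))

    new<out : ∀ {c} → c ∈ U → v ⟶ c → ρ i v < ρ i c
    new<out {c} c∈ e = new<old (proj₂ (∈-minus⁻ c∈))
      (≤-trans (≤-reflexive θi) (proj₂ (proj₂ cut) λ a∈ →
        let a∈In , a∈U = ∈-filter⁻ (_∈? U) a∈ in sep a∈U c∈ a∈In e))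

    maj : ∀ {x y} → x ∈ W → y ∈ W → x ⟶ y → Σ (Fin 3) λ k₀ → ∀ k → k ≢ k₀ → ρ k x < ρ k y
    maj {x} {y} x∈ y∈ e = cases (x ≟ v) (y ≟ v)
      where
      cases : Dec (x ≡ v) → Dec (y ≡ v) → Σ (Fin 3) λ k₀ → ∀ k → k ≢ k₀ → ρ k x < ρ k y
      cases (yes refl) (yes refl) = contradiction e irrefl
      cases (yes refl) (no y≢v) = λ′ , λ k k≢λ → go k k≢λ (exhaust i φ λ′ i≢φ i≢λ φ≢λ k)
        where
        go : ∀ k → k ≢ λ′ → k ≡ i ⊎ k ≡ φ ⊎ k ≡ λ′ → ρ k v < ρ k y
        go k _   (inj₁ refl)        = new<out (x∈p∧x≢y⇒x∈p-y y∈ y≢v) e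
        go k _   (inj₂ (inj₁ refl)) = fst y∈ y≢v
        go k k≢λ (inj₂ (inj₂ k≡λ))  = contradiction k≡λ k≢λ
      cases (no x≢v) (yes refl) = φ , λ k k≢φ → go k k≢φ (exhaust i φ λ′ i≢φ i≢λ φ≢λ k)
        where
        go : ∀ k → k ≢ φ → k ≡ i ⊎ k ≡ φ ⊎ k ≡ λ′ → ρ k x < ρ k v
        go k _   (inj₁ refl)        = in<new (x∈p∧x≢y⇒x∈p-y x∈ x≢v) e
        go k k≢φ (inj₂ (inj₁ k≡φ))  = contradiction k≡φ k≢φ
        go k _   (inj₂ (inj₂ refl)) = lst x∈ x≢v
      cases (no x≢v) (no y≢v) =
        let k₀ , h = majority g (x∈p∧x≢y⇒x∈p-y x∈ x≢v) (x∈p∧x≢y⇒x∈p-y y∈ y≢v) e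
        in k₀ , λ k k≢ → old<old x≢v y≢v (h k k≢)

    mix : ∀ {x y} → x ∈ W → y ∈ W → x ≢ y → Σ (Fin 3) λ k → ρ k x < ρ k y
    mix {x} {y} x∈ y∈ x≢y = cases (x ≟ v) (y ≟ v)
      where
      cases : Dec (x ≡ v) → Dec (y ≡ v) → Σ (Fin 3) λ k → ρ k x < ρ k y
      cases (yes refl) (yes refl) = contradiction refl x≢y
      cases (yes refl) (no y≢v) = φ , fst y∈ y≢v
      cases (no x≢v) (yes refl) = λ′ , lst x∈ x≢v
      cases (no x≢v) (no y≢v) =
        let k , h = mixed g (x∈p∧x≢y⇒x∈p-y x∈ x≢v) (x∈p∧x≢y⇒x∈p-y y∈ y≢v) x≢y
        in k , old<old x≢v y≢v h

  -- Unfolding the ranks of nested insertions makes later type checking infeasible.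
  opaque
    insert : ∀ {W v r i φ λ′} → Good (W - v) r → Separated (W - v) v i r →
      i ≢ φ → i ≢ λ′ → φ ≢ λ′ → Inserted W v φ λ′ r
    insert = insert-transparent

  -- Neighbours inside a vertex set.

  backIn backOut : Subset n → Fin n → List (Fin n)
  backIn  U v = filter (_∈? U) (In v)
  backOut U v = filter (_∈? U) (Out v)

  backDegree : Subset n → Fin n → ℕ
  backDegree U v = length (backIn U v) + length (backOut U v)

  Thin : Subset n → Fin n → Set
  Thin U v = length (backIn U v) ≤ 1 ⊎ length (backOut U v) ≤ 1

  Thin? : ∀ U v → Dec (Thin U v)
  Thin? U v = (length (backIn U v) ≤? 1) ⊎-dec (length (backOut U v) ≤? 1)

  backDegree-≤4 : ∀ U v → backDegree U v ≤ 4
  backDegree-≤4 U v =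
    ≤-trans (+-mono-≤ (length-filter (_∈? U) (In v)) (length-filter (_∈? U) (Out v))) (degree≤4 v)

  backDegree-strict : ∀ {U U′ x v} → U ⊆ U′ → x ∈ U′ → x ∉ U → Adjacent x v → backDegree U v < backDegree U′ v
  backDegree-strict {U} {U′} {x} {v} U⊆U′ x∈ x∉ (inj₁ e) = +-mono-<-≤
    (length-filter-strict (_∈? U) (_∈? U′) U⊆U′ (In v) e x∈ x∉)
    (length-filter-mono (_∈? U) (_∈? U′) U⊆U′ (Out v))
  backDegree-strict {U} {U′} {x} {v} U⊆U′ x∈ x∉ (inj₂ e) = +-mono-≤-<
    (length-filter-mono (_∈? U) (_∈? U′) U⊆U′ (In v))
    (length-filter-strict (_∈? U) (_∈? U′) U⊆U′ (Out v) (In⇒Out e) x∈ x∉)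

  sum≤3 : ∀ p q → p + q ≤ 3 → p ≤ 1 ⊎ q ≤ 1
  sum≤3 zero          q             _ = inj₁ z≤n
  sum≤3 (suc zero)    q             _ = inj₁ (s≤s z≤n)
  sum≤3 (suc (suc p)) zero          _ = inj₂ z≤n
  sum≤3 (suc (suc p)) (suc zero)    _ = inj₂ (s≤s z≤n)
  sum≤3 (suc (suc p)) (suc (suc q)) (s≤s (s≤s h)) with p + suc (suc q) | +-comm p (suc (suc q))
  sum≤3 (suc (suc p)) (suc (suc q)) (s≤s (s≤s (s≤s ()))) | _ | refl

  -- Losing `x` leaves at most three neighbours, and three cannot put two on each side.
  missing-thin : ∀ {U x v} → x ∉ U → Adjacent x v → Thin U v
  missing-thin {U} {x} {v} x∉ adj = sum≤3 _ _
    (s≤s⁻¹ (<-≤-trans (backDegree-strict (λ _ → ∈⊤) ∈⊤ x∉ adj) (backDegree-≤4 ⊤ v)))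

  -- One side of `v` is empty in `U`, phrased so that `Separated` has nothing to check.
  Vacuous : Subset n → Fin n → Set
  Vacuous U v = ∀ {a c} → a ∈ U → c ∈ U → a ⟶ v → ¬ v ⟶ c

  Lone : Subset n → Fin n → Fin n → Set
  Lone U v x = (∀ {a} → a ∈ U → a ⟶ v → a ≡ x) ⊎ (∀ {c} → c ∈ U → v ⟶ c → c ≡ x)

  atMostOne : ∀ (xs : List (Fin n)) → length xs ≤ 1 →
    (∀ {x} → ¬ x ∈ˡ xs) ⊎ Σ (Fin n) λ c → c ∈ˡ xs × ∀ {y} → y ∈ˡ xs → y ≡ c
  atMostOne []          _ = inj₁ λ ()
  atMostOne (c ∷ [])    _ = inj₂ (c , here refl , λ { (here p) → p })
  atMostOne (_ ∷ _ ∷ _) (s≤s ())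

  backIn⁺ : ∀ {U v a} → a ∈ U → a ⟶ v → a ∈ˡ backIn U v
  backIn⁺ {U} a∈ e = ∈-filter⁺ (_∈? U) e a∈

  backOut⁺ : ∀ {U v c} → c ∈ U → v ⟶ c → c ∈ˡ backOut U v
  backOut⁺ {U} c∈ e = ∈-filter⁺ (_∈? U) (In⇒Out e) c∈

  backIn⁻ : ∀ {U v a} → a ∈ˡ backIn U v → a ∈ U × a ⟶ v
  backIn⁻ {U} a∈ = let e , a∈U = ∈-filter⁻ (_∈? U) a∈ in a∈U , e

  backOut⁻ : ∀ {U v c} → c ∈ˡ backOut U v → c ∈ U × v ⟶ c
  backOut⁻ {U} c∈ = let e , c∈U = ∈-filter⁻ (_∈? U) c∈ in c∈U , Out⇒In e

  thin-cases : ∀ {U v} → Thin U v → Vacuous U v ⊎ Σ (Fin n) λ x → x ∈ U × Adjacent v x × Lone U v x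
  thin-cases {U} {v} (inj₁ le) with atMostOne (backIn U v) le
  ... | inj₁ none = inj₁ λ a∈ _ e _ → none (backIn⁺ a∈ e)
  ... | inj₂ (x , x∈ , only) = let x∈U , e = backIn⁻ x∈ in
    inj₂ (x , x∈U , inj₂ e , inj₁ λ a∈ e → only (backIn⁺ a∈ e))
  thin-cases {U} {v} (inj₂ le) with atMostOne (backOut U v) le
  ... | inj₁ none = inj₁ λ _ c∈ _ e → none (backOut⁺ c∈ e)
  ... | inj₂ (x , x∈ , only) = let x∈U , e = backOut⁻ x∈ in
    inj₂ (x , x∈U , inj₁ e , inj₂ λ c∈ e → only (backOut⁺ c∈ e))

  OneEach : Subset n → Fin n → Set
  OneEach U v = Σ (Fin n) λ q → Σ (Fin n) λ s → q ∈ U × s ∈ U × q ⟶ v × v ⟶ s ×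
    (∀ {a} → a ∈ U → a ⟶ v → a ≡ q) × (∀ {c} → c ∈ U → v ⟶ c → c ≡ s)

  backDegree≤2-cases : ∀ {U v} → backDegree U v ≤ 2 → Vacuous U v ⊎ OneEach U v
  backDegree≤2-cases {U} {v} = cases (backIn U v) (backOut U v) backIn⁺ backOut⁺ backIn⁻ backOut⁻
    where
    cases : ∀ xs ys → (∀ {a} → a ∈ U → a ⟶ v → a ∈ˡ xs) → (∀ {c} → c ∈ U → v ⟶ c → c ∈ˡ ys) →
      (∀ {a} → a ∈ˡ xs → a ∈ U × a ⟶ v) → (∀ {c} → c ∈ˡ ys → c ∈ U × v ⟶ c) →
      length xs + length ys ≤ 2 → Vacuous U v ⊎ OneEach U v
    cases [] ys i⁺ o⁺ i⁻ o⁻ _ = inj₁ λ { a∈ _ e _ → contradiction (i⁺ a∈ e) λ () }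
    cases (_ ∷ _) [] i⁺ o⁺ i⁻ o⁻ _ = inj₁ λ { _ c∈ _ e → contradiction (o⁺ c∈ e) λ () }
    cases (q ∷ []) (s ∷ []) i⁺ o⁺ i⁻ o⁻ _ =
      let q∈ , eq = i⁻ (here refl) ; s∈ , es = o⁻ (here refl) in
      inj₂ (q , s , q∈ , s∈ , eq , es ,
        (λ a∈ e → singleton (i⁺ a∈ e)) , λ c∈ e → singleton (o⁺ c∈ e))
      where
      singleton : ∀ {x y : Fin n} → x ∈ˡ y ∷ [] → x ≡ y
      singleton (here p) = p
    cases (_ ∷ []) (_ ∷ _ ∷ _) i⁺ o⁺ i⁻ o⁻ (s≤s (s≤s ()))
    cases (_ ∷ _ ∷ xs) (_ ∷ ys) i⁺ o⁺ i⁻ o⁻ (s≤s (s≤s h))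
      with length xs + suc (length ys) | +-comm (length xs) (suc (length ys))
    cases (_ ∷ _ ∷ xs) (_ ∷ ys) i⁺ o⁺ i⁻ o⁻ (s≤s (s≤s ())) | _ | refl

  -- Preparing a thin vertex.

  lone-separated : ∀ {U v x φ λ′} r → Lone U v x → First U x φ r → Last U x λ′ r →
    Σ (Fin 3) λ i → Separated U v i r
  lone-separated {φ = φ} r (inj₁ only) first _ = φ , λ a∈ c∈ a⟶v v⟶c → case only a∈ a⟶v of λ where
    refl → first c∈ λ { refl → asym a⟶v v⟶c }
  lone-separated {λ′ = λ′} r (inj₂ only) _ last = λ′ , λ a∈ c∈ a⟶v v⟶c → case only c∈ v⟶c of λ where
    refl → last a∈ λ { refl → asym a⟶v v⟶c }

  vacuous-separated : ∀ {U v} i r → Vacuous U v → Separated U v i r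
  vacuous-separated i r vac a∈ c∈ e e′ = contradiction e′ (vac a∈ c∈ e)

  -- Of three indices only `i` and `k` are barred from being `φ`, so one is always left.
  insertFirst≢ : ∀ {W v r i} → Good (W - v) r → Separated (W - v) v i r → (k : Fin 3) →
    Σ (Fin 3) λ φ → Σ (Fin 3) λ λ′ → φ ≢ k × Inserted W v φ λ′ r
  insertFirst≢ {i = i} g sep k =
    let φ , i≢φ , k≢φ = third i k
        λ′ , i≢λ , φ≢λ = third i φ
    in φ , λ′ , k≢φ ∘ sym , insert g sep i≢φ i≢λ φ≢λ

  insertLast≢ : ∀ {W v r i} → Good (W - v) r → Separated (W - v) v i r → (k : Fin 3) →
    Σ (Fin 3) λ φ → Σ (Fin 3) λ λ′ → λ′ ≢ k × Inserted W v φ λ′ r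
  insertLast≢ {i = i} g sep k =
    let λ′ , i≢λ , k≢λ = third i k
        φ , i≢φ , λ≢φ = third i λ′
    in φ , λ′ , k≢λ ∘ sym , insert g sep i≢φ i≢λ (λ≢φ ∘ sym)

  insertAny : ∀ {W v} → Prepared W v → Σ (Fin 3) λ φ → Σ (Fin 3) λ λ′ → Σ (Ranking n) λ r → Inserted W v φ λ′ r
  insertAny (r , g , i , sep) = let φ , λ′ , _ , s = insertFirst≢ g sep i in φ , λ′ , r , s

  -- `Prepare` leaves `v` unranked, so that its user can still choose where `v` goes first and last.
  -- Bounding the size lets the hypothesis apply after any number of removals.
  Solve Prepare : ℕ → Set
  Solve   k = ∀ {W} → ∣ W ∣ ≤ k → Σ (Ranking n) (Good W)
  Prepare k = ∀ {W v} → ∣ W ∣ ≤ k → v ∈ W → Thin (W - v) v → Prepared W v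

  size-remove : ∀ {W : Subset n} {v k} → v ∈ W → ∣ W ∣ ≤ suc k → ∣ W - v ∣ ≤ k
  size-remove v∈ le = s≤s⁻¹ (<-≤-trans (x∈p⇒∣p-x∣<∣p∣ v∈) le)

  size-remove′ : ∀ (W : Subset n) {v k} → ∣ W ∣ ≤ k → ∣ W - v ∣ ≤ k
  size-remove′ W le = ≤-trans (∣p─q∣≤∣p∣ W _) le

  size-zero : ∀ {W : Subset n} {v} → v ∈ W → ¬ ∣ W ∣ ≤ 0
  size-zero v∈ le with ≤-trans (x∈p⇒∣p-x∣<∣p∣ v∈) le
  ... | ()

  removed : ∀ {W : Subset n} {v} → v ∉ W - v
  removed v∈ = proj₂ (∈-minus⁻ v∈) refl

  remains : ∀ {W : Subset n} {u v} → u ∉ W → u ∉ W - v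
  remains u∉ u∈ = u∉ (proj₁ (∈-minus⁻ u∈))

  -- The lone neighbour `x` has itself lost `v`, so it is thin and can be prepared by induction.
  -- Inserting it makes it first in one ranking and last in another, and one of these separates the
  -- neighbours of `v`.
  prepare-step : ∀ {k} → Solve k → Prepare k → Prepare (suc k)
  prepare-step solve prepare le v∈ thin with thin-cases thin
  ... | inj₁ vac =
    let r , g = solve (size-remove v∈ le) in r , g , zero , vacuous-separated zero r vac
  ... | inj₂ (x , x∈ , adj , lone) =
    let φ , λ′ , r , s = insertAny (prepare (size-remove v∈ le) x∈ (missing-thin (remains removed) adj))
        open Inserted s
        i , sep = lone-separated ρ lone first last
    in ρ , good , i , sep

  -- Forcing two vertices below a third.

  BothBefore : (a b c : Fin n) → Fin 3 → Ranking n → Set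
  BothBefore a b c k r = r k a < r k c × r k b < r k c

  -- Having lost o and v, the vertex a has at most two neighbours left.  Since a ↛ c, inserting c immediately
  -- before a can be done so that c is last in a ranking other than the one separating these neighbours; there
  -- a can go first.
  insertBefore : ∀ {K U v o a b c} → Prepare K → ∣ U ∣ ≤ K → o ∉ U → v ∉ U → v ≢ o →
    a ∈ U → b ∈ U → c ∈ U → a ≢ b → a ⟶ o → b ⟶ o → o ⟶ c → ¬ a ⟶ c → Adjacent v a →
    Σ (Fin 3) λ φ → Σ (Fin 3) λ λ′ → Σ (Ranking n) λ r → Σ (Inserted U a φ λ′ r) λ s → BothBefore a b c φ (Inserted.ρ s)
  insertBefore {K} {U} {v} {o} {a} {b} {c} prepare le o∉ v∉ v≢o a∈ b∈ c∈ a≢b ao bo oc ¬ac adj =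
    finish (split (backDegree≤2-cases degree≤2))
    where
    c≢a : c ≢ a
    c≢a refl = asym ao oc
    c≢b : c ≢ b
    c≢b refl = asym bo oc
    c∈′ : c ∈ U - a
    c∈′ = x∈p∧x≢y⇒x∈p-y c∈ c≢a
    b∈′ : b ∈ U - a
    b∈′ = x∈p∧x≢y⇒x∈p-y b∈ (a≢b ∘ sym)

    degree≤2 : backDegree (U - a) a ≤ 2
    degree≤2 = s≤s⁻¹ (<-≤-trans
      (backDegree-strict {U′ = ⊤ - o} (λ x∈ → x∈p∧x≢y⇒x∈p-y ∈⊤ λ { refl → remains o∉ x∈ })
        (x∈p∧x≢y⇒x∈p-y ∈⊤ v≢o) (remains v∉) adj)
      (s≤s⁻¹ (<-≤-trans (backDegree-strict {U′ = ⊤} (λ _ → ∈⊤) ∈⊤ removed (inj₂ ao)) (backDegree-≤4 ⊤ a))))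

    Split : Set
    Split = Σ (Ranking n) λ r → Good (U - a) r × Σ (Fin 3) λ τ → Σ (Fin 3) λ i → τ ≢ i ×
      Separated (U - a) a τ r × r i b < r i c

    prepared : Prepared (U - a) c
    prepared = prepare (size-remove′ U le) c∈′ (missing-thin (remains (remains o∉)) (inj₁ oc))

    split : Vacuous (U - a) a ⊎ OneEach (U - a) a → Split
    split (inj₁ vac) with insertAny prepared
    ... | φ , λ′ , _ , s =
      -- With nothing to separate, any `τ` other than the ranking where `c` is last will do.
      let open Inserted s ; τ , λ≢τ , _ = third λ′ λ′ in
      ρ , good , τ , λ′ , λ≢τ ∘ sym , vacuous-separated τ ρ vac , last b∈′ (c≢b ∘ sym)
    split (inj₂ (q , s , q∈ , s∈ , qa , as , onlyIn , onlyOut)) with c ≟ q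
    -- Here `c` is the lone in-neighbour of `a`: it separates where it is first, and is above `b`
    -- where it is last.
    ... | yes refl with insertAny prepared
    ...   | φ , λ′ , _ , st =
      let open Inserted st in
      ρ , good , φ , λ′ , distinct ,
      (λ x∈ y∈ xa ay → case onlyIn x∈ xa of λ where
        refl → first y∈ λ { refl → asym qa ay }) ,
      last b∈′ (c≢b ∘ sym)
    split (inj₂ (q , s , q∈ , s∈ , qa , as , onlyIn , onlyOut)) | no c≢q
      with prepared
    ... | r , g , i , sep
      -- Some `τ` has `q` below `s`, and inserting `c` preserves this; `c` is made last in a ranking
      -- other than `τ`.
      with mixed g {q} {s} (x∈p∧x≢y⇒x∈p-y q∈ (c≢q ∘ sym)) (x∈p∧x≢y⇒x∈p-y s∈ s≢c) (λ { refl → asym qa as })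
      where
      s≢c : s ≢ c
      s≢c refl = ¬ac as
    ...   | τ , q<s with insertLast≢ g sep τ
    ...     | φ , λ′ , λ≢τ , st =
      let open Inserted st in
      ρ , good , τ , λ′ , λ≢τ ∘ sym ,
      (λ x∈ y∈ xa ay → case (onlyIn x∈ xa , onlyOut y∈ ay) of λ where
        (refl , refl) → keep τ (c≢q ∘ sym) (λ { refl → ¬ac as }) q<s) ,
      last b∈′ (c≢b ∘ sym)

    finish : Split → _
    finish (r , g , τ , i , τ≢i , sep , b<c) =
      -- `a` goes first in `i`, where `b` is already below `c`.
      let λ′ , τ≢λ , i≢λ = third τ i
          s = insert g sep τ≢i τ≢λ i≢λ
          open Inserted s
      in i , λ′ , r , s , first c∈ c≢a , keep i (a≢b ∘ sym) c≢a b<c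

  -- The chain of lone neighbours is followed from v until it meets c, a or b, or a vertex with nothing to
  -- separate; at that point a ranking with a and b below c is available, and later insertions keep it.
  module Tripod {K : ℕ} (prepare : Prepare K) {o a b c : Fin n} (a≢b : a ≢ b)
    (ao : a ⟶ o) (bo : b ⟶ o) (oc : o ⟶ c) (¬ac : ¬ a ⟶ c) (¬bc : ¬ b ⟶ c) where

    Prepared⁺ : Subset n → Fin n → Set
    Prepared⁺ U v = Σ (Ranking n) λ r → Good (U - v) r × (Σ (Fin 3) λ i → Separated (U - v) v i r) ×
      Σ (Fin 3) λ k → BothBefore a b c k r

    Inserted⁺ : Subset n → Fin n → Set
    Inserted⁺ U x = Σ (Fin 3) λ φ → Σ (Fin 3) λ λ′ → Σ (Ranking n) λ r → Σ (Inserted U x φ λ′ r) λ s →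
      Σ (Fin 3) λ k → BothBefore a b c k (Inserted.ρ s)

    c≢a : c ≢ a
    c≢a refl = asym ao oc
    c≢b : c ≢ b
    c≢b refl = asym bo oc

    Contains : Subset n → Set
    Contains U = a ∈ U × b ∈ U × c ∈ U

    -- Having lost `o`, the vertex `c` is thin; once inserted, it is above `a` and `b` in the
    -- ranking where it is last.
    insertHub : ∀ {U} → ∣ U ∣ ≤ K → o ∉ U → Contains U → Inserted⁺ U c
    insertHub le o∉ (a∈ , b∈ , c∈)
      with insertAny (prepare le c∈ (missing-thin (remains o∉) (inj₁ oc)))
    ... | φ , λ′ , r , s = φ , λ′ , r , s , λ′ , last a∈ (c≢a ∘ sym) , last b∈ (c≢b ∘ sym)
      where open Inserted s

    -- The absent neighbour `x` makes `v` thin. The bound `j` drops with each vertex removed along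
    -- the chain, while `K` stays fixed as the range of `prepare`.
    prepare⁺ : ∀ j {U v x} → ∣ U ∣ ≤ j → ∣ U ∣ ≤ K → o ∉ U → Contains (U - v) → v ∈ U →
      x ∉ U → Adjacent x v → Prepared⁺ U v
    insert⁺ : ∀ j {U v x} → ∣ U ∣ ≤ j → ∣ U ∣ ≤ K → o ∉ U → v ∉ U → v ≢ o → Contains U → x ∈ U →
      Adjacent v x → Inserted⁺ U x

    prepare⁺ zero    le _ _ _ v∈ _ _ = contradiction le (size-zero v∈)
    prepare⁺ (suc j) {U} {v} le leK o∉ abc v∈ x∉ adj with thin-cases (missing-thin (remains {v = v} x∉) adj)
    ... | inj₁ vac with insertHub (size-remove′ U leK) (remains o∉) abc
    ...   | φ , λ′ , _ , s , k , T = ρ , good , (zero , vacuous-separated zero ρ vac) , k , T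
      where open Inserted s
    prepare⁺ (suc j) {U} {v} le leK o∉ abc v∈ x∉ adj | inj₂ (y , y∈ , vy , lone)
      with insert⁺ j (size-remove v∈ le) (size-remove′ U leK) (remains o∉) removed (λ { refl → o∉ v∈ }) abc y∈ vy
    ... | φ , λ′ , _ , s , k , T = ρ , good , lone-separated ρ lone first last , k , T
      where open Inserted s

    insert⁺ j {U} {v} {x} le leK o∉ v∉ v≢o abc@(a∈ , b∈ , c∈) x∈ vx with x ≟ c | x ≟ a | x ≟ b
    ... | yes refl | _ | _ = insertHub leK o∉ abc
    ... | no _ | yes refl | _
      with insertBefore prepare leK o∉ v∉ v≢o a∈ b∈ c∈ a≢b ao bo oc ¬ac vx
    ...   | φ , λ′ , r , s , T = φ , λ′ , r , s , φ , T
    insert⁺ j {U} {v} {x} le leK o∉ v∉ v≢o abc@(a∈ , b∈ , c∈) x∈ vx | no _ | no _ | yes refl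
      with insertBefore prepare leK o∉ v∉ v≢o b∈ a∈ c∈ (a≢b ∘ sym) bo ao oc ¬bc vx
    ...   | φ , λ′ , r , s , T = φ , λ′ , r , s , φ , proj₂ T , proj₁ T
    insert⁺ j {U} {v} {x} le leK o∉ v∉ v≢o abc@(a∈ , b∈ , c∈) x∈ vx | no x≢c | no x≢a | no x≢b
      with prepare⁺ j le leK o∉ (x∈p∧x≢y⇒x∈p-y a∈ (x≢a ∘ sym) , x∈p∧x≢y⇒x∈p-y b∈ (x≢b ∘ sym) ,
        x∈p∧x≢y⇒x∈p-y c∈ (x≢c ∘ sym)) x∈ v∉ vx
    ... | r , g , (i , sep) , k , a<c , b<c with insertFirst≢ {r = r} g sep i
    ...   | φ , λ′ , _ , s = φ , λ′ , r , s , k , keep k (x≢a ∘ sym) (x≢c ∘ sym) a<c , keep k (x≢b ∘ sym) (x≢c ∘ sym) b<c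
      where open Inserted s

  -- Subgraphs with all in- and out-degrees two.

  Pair : (Fin n → Set) → Set
  Pair P = Σ (Fin n) λ p → Σ (Fin n) λ q → p ≢ q × P p × P q × (∀ {x} → P x → x ≡ p ⊎ x ≡ q)

  partner : ∀ {P u} → Pair P → P u → Σ (Fin n) λ e → e ≢ u × P e × (∀ {x} → P x → x ≡ u ⊎ x ≡ e)
  partner (p , q , p≢q , Pp , Pq , cover) Pu with cover Pu
  ... | inj₁ refl = q , p≢q ∘ sym , Pq , cover
  ... | inj₂ refl = p , p≢q , Pp , swap ∘ cover

  pair : ∀ {xs} → Unique xs → 2 ≤ length xs → length xs ≤ 2 → Pair (_∈ˡ xs)
  pair {[]}                _                   ()
  pair {_ ∷ []}            _                   (s≤s ())
  pair {p ∷ q ∷ []}        ((p≢q ∷ []) ∷ _)    _ _ =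
    p , q , p≢q , here refl , there (here refl) , λ where
      (here e)         → inj₁ e
      (there (here e)) → inj₂ e
  pair {_ ∷ _ ∷ _ ∷ _} _ _ (s≤s (s≤s ()))

  Pair-map : ∀ {P Q : Fin n → Set} → (∀ {x} → P x → Q x) → (∀ {x} → Q x → P x) → Pair P → Pair Q
  Pair-map f g (p , q , p≢q , Pp , Pq , cover) = p , q , p≢q , f Pp , f Pq , cover ∘ g

  Dense : Subset n → Set
  Dense W = ∀ {v} → v ∈ W → Pair (λ x → x ∈ W × x ⟶ v) × Pair (λ x → x ∈ W × v ⟶ x)

  sum≤4 : ∀ {p q} → ¬ p ≤ 1 → ¬ q ≤ 1 → p + q ≤ 4 → p ≤ 2 × q ≤ 2
  sum≤4 {p} {q} p≰1 q≰1 le =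
    s≤s⁻¹ (s≤s⁻¹ (≤-trans (≤-reflexive (+-comm 2 p)) (≤-trans (+-mono-≤ (≤-refl {p}) (≰⇒> q≰1)) le))) ,
    s≤s⁻¹ (s≤s⁻¹ (≤-trans (+-mono-≤ (≰⇒> p≰1) (≤-refl {q})) le))

  -- Both sides exceed one and together have at most four vertices, so each has exactly two. Absence
  -- of loops carries the count from `W - v` to `W`.
  thick⇒dense : ∀ {W} → (∀ {v} → v ∈ W → ¬ Thin (W - v) v) → Dense W
  thick⇒dense {W} thick {v} v∈ =
    let i≤2 , o≤2 = sum≤4 (thick v∈ ∘ inj₁) (thick v∈ ∘ inj₂) (backDegree-≤4 (W - v) v) in
    Pair-map (λ x∈ → let x∈′ , e = backIn⁻ x∈ in proj₁ (∈-minus⁻ x∈′) , e)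
      (λ (x∈ , e) → backIn⁺ (x∈p∧x≢y⇒x∈p-y x∈ (⟶⇒≢ e)) e)
      (pair (Unique.filter⁺ (_∈? (W - v)) (In-unique v)) (≰⇒> (thick v∈ ∘ inj₁)) i≤2) ,
    Pair-map (λ x∈ → let x∈′ , e = backOut⁻ x∈ in proj₁ (∈-minus⁻ x∈′) , e)
      (λ (x∈ , e) → backOut⁺ (x∈p∧x≢y⇒x∈p-y x∈ (⟶⇒≢ e ∘ sym)) e)
      (pair (Unique.filter⁺ (_∈? (W - v)) (Out-unique v)) (≰⇒> (thick v∈ ∘ inj₂)) o≤2)

  Transitive : Subset n → Fin n → Fin n → Fin n → Set
  Transitive W a m s = (a ∈ W × m ∈ W × s ∈ W) × a ⟶ m × m ⟶ s × a ⟶ s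

  Transitive? : ∀ W → Dec (Σ (Fin n) λ a → Σ (Fin n) λ m → Σ (Fin n) λ s → Transitive W a m s)
  Transitive? W = any? λ a → any? λ m → any? λ s →
    ((a ∈? W) ×-dec ((m ∈? W) ×-dec (s ∈? W))) ×-dec ((a ⟶? m) ×-dec ((m ⟶? s) ×-dec (a ⟶? s)))

  -- With `s` absent, `m` is thin and is the lone out-neighbour of `a`. By density, `a` and `m` are
  -- the only in-neighbours of `s`.
  solve-transitive : ∀ {k W a m s} → Prepare k → ∣ W ∣ ≤ suc k → Dense W → Transitive W a m s →
    Σ (Ranking n) (Good W)
  solve-transitive {k} {W} {a} {m} {s} prepare le dense ((a∈ , m∈ , s∈) , am , ms , as) = ranking
    where
    m∈₂ : m ∈ W - s - a
    m∈₂ = x∈p∧x≢y⇒x∈p-y (x∈p∧x≢y⇒x∈p-y m∈ (⟶⇒≢ ms)) (⟶⇒≢ am ∘ sym)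

    outs-a : ∀ {c} → c ∈ W - s → a ⟶ c → c ≡ m
    outs-a c∈ ac with partner (proj₂ (dense a∈)) (s∈ , as)
    ... | e , _ , _ , cover with cover (m∈ , am) | cover (proj₁ (∈-minus⁻ c∈) , ac)
    ...   | inj₁ refl | _         = contradiction ms irrefl
    ...   | inj₂ _    | inj₁ refl = contradiction c∈ removed
    ...   | inj₂ refl | inj₂ c≡m  = c≡m

    ins-s : ∀ {x} → x ∈ W → x ⟶ s → x ≡ a ⊎ x ≡ m
    ins-s x∈ xs with partner (proj₁ (dense s∈)) (a∈ , as)
    ... | e , _ , _ , cover with cover (m∈ , ms)
    ...   | inj₁ refl = contradiction am irrefl
    ...   | inj₂ refl = cover (x∈ , xs)

    ranking : Σ (Ranking n) (Good W)
    ranking with insertAny (prepare (size-remove′ (W - s) (size-remove s∈ le)) m∈₂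
                   (missing-thin (remains (remains removed)) (inj₂ ms)))
    ... | φ , λ′ , _ , I₁ = ranking′
      where
      module I₁ = Inserted I₁
      sep-a : Separated (W - s - a) a λ′ I₁.ρ
      sep-a x∈ c∈ xa ac with outs-a (proj₁ (∈-minus⁻ c∈)) ac
      ... | refl = I₁.last x∈ λ { refl → asym xa am }

      -- `a` goes first in `φ`, where `m` was first, so the two become the lowest vertices of `φ`
      -- and separate the neighbours of `s`.
      ψ = third λ′ φ
      I₂ : Inserted (W - s) a φ (proj₁ ψ) I₁.ρ
      I₂ = insert I₁.good sep-a (I₁.distinct ∘ sym) (proj₁ (proj₂ ψ)) (proj₂ (proj₂ ψ))
      module I₂ = Inserted I₂

      sep-s : Separated (W - s) s φ I₂.ρ
      sep-s x∈ c∈ xs sc with ins-s (proj₁ (∈-minus⁻ x∈)) xs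
      ... | inj₁ refl = I₂.first c∈ λ { refl → asym as sc }
      ... | inj₂ refl = I₂.keep φ (⟶⇒≢ am ∘ sym) c≢a
          (I₁.first (x∈p∧x≢y⇒x∈p-y c∈ c≢a) λ { refl → asym ms sc })
        where
        c≢a : _ ≢ a
        c≢a refl = asym as sc

      ranking′ : Σ (Ranking n) (Good W)
      ranking′ with insertAny (I₂.ρ , I₂.good , φ , sep-s)
      ... | _ , _ , _ , I₃ = Inserted.ρ I₃ , Inserted.good I₃

  -- Without transitive triangles `a` and `b` have no arc to `c`, as `Tripod` requires, and `e`
  -- differs from `a`, `b` and `c`, so inserting it preserves their order.
  solve-intransitive : ∀ {k W o} → Prepare k → ∣ W ∣ ≤ suc k → Dense W → o ∈ W →
    (∀ {a m s} → ¬ Transitive W a m s) → Σ (Ranking n) (Good W)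
  solve-intransitive {k} {W} {o} prepare le dense o∈ intransitive
    with dense o∈
  ... | (a , b , a≢b , (a∈ , ao) , (b∈ , bo) , ins-o) , (c , d , c≢d , (c∈ , oc) , (d∈ , od) , outs-o)
    with partner (proj₁ (dense d∈)) (o∈ , od)
  ... | e , e≢o , (e∈ , ed) , ins-d = ranking
    where
    ¬ac : ¬ a ⟶ c
    ¬ac ac = intransitive ((a∈ , o∈ , c∈) , ao , oc , ac)
    ¬bc : ¬ b ⟶ c
    ¬bc bc = intransitive ((b∈ , o∈ , c∈) , bo , oc , bc)
    a≢e : a ≢ e
    a≢e refl = intransitive ((a∈ , o∈ , d∈) , ao , od , ed)
    b≢e : b ≢ e
    b≢e refl = intransitive ((b∈ , o∈ , d∈) , bo , od , ed)
    c≢e : c ≢ e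
    c≢e refl = intransitive ((o∈ , c∈ , d∈) , oc , ed , od)
    a≢d : a ≢ d
    a≢d refl = asym ao od
    b≢d : b ≢ d
    b≢d refl = asym bo od

    U : Subset n
    U = W - o - d
    member : ∀ {x} → x ∈ W → x ≢ o → x ≢ d → x ∈ U
    member x∈ x≢o x≢d = x∈p∧x≢y⇒x∈p-y (x∈p∧x≢y⇒x∈p-y x∈ x≢o) x≢d
    a∈U : a ∈ U
    a∈U = member a∈ (⟶⇒≢ ao) a≢d
    b∈U : b ∈ U
    b∈U = member b∈ (⟶⇒≢ bo) b≢d
    c∈U : c ∈ U
    c∈U = member c∈ (⟶⇒≢ oc ∘ sym) c≢d
    U≤k : ∣ U ∣ ≤ k
    U≤k = size-remove′ (W - o) (size-remove o∈ le)

    open Tripod prepare a≢b ao bo oc ¬ac ¬bc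

    prepared : Prepared⁺ U e
    prepared = prepare⁺ k U≤k U≤k (remains removed)
      (x∈p∧x≢y⇒x∈p-y a∈U a≢e , x∈p∧x≢y⇒x∈p-y b∈U b≢e , x∈p∧x≢y⇒x∈p-y c∈U c≢e)
      (member e∈ e≢o (⟶⇒≢ ed)) removed (inj₂ ed)

    ranking : Σ (Ranking n) (Good W)
    ranking with prepared
    -- With `o` absent, `e` is the lone in-neighbour of `d`, so `φ` will separate for `d`. It must
    -- avoid `t`, where `d` is to be last.
    ... | r , g , (i , sep) , t , a<c , b<c with insertFirst≢ {r = r} g sep t
    ... | φ , λ′ , φ≢t , I₁ = ranking′
      where
      module I₁ = Inserted I₁
      sep-d : Separated U d φ I₁.ρ
      sep-d x∈ y∈ xd dy with ins-d (proj₁ (∈-minus⁻ (proj₁ (∈-minus⁻ x∈))) , xd)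
      ... | inj₁ refl = contradiction x∈ (remains removed)
      ... | inj₂ refl = I₁.first y∈ λ { refl → asym ed dy }

      ψ = third φ t
      I₂ : Inserted (W - o) d (proj₁ ψ) t I₁.ρ
      I₂ = insert I₁.good sep-d (proj₁ (proj₂ ψ)) φ≢t (proj₂ (proj₂ ψ) ∘ sym)
      module I₂ = Inserted I₂

      lift : ∀ {x y} → x ≢ e → x ≢ d → y ≢ e → y ≢ d → r t x < r t y → I₂.ρ t x < I₂.ρ t y
      lift x≢e x≢d y≢e y≢d lt = I₂.keep t x≢d y≢d (I₁.keep t x≢e y≢e lt)

      -- In `t` both `c` and the last vertex `d` now lie above `a` and `b`.
      sep-o : Separated (W - o) o t I₂.ρ
      sep-o x∈ y∈ xo oy with outs-o (proj₁ (∈-minus⁻ y∈) , oy)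
      ... | inj₂ refl = I₂.last x∈ λ { refl → asym xo oy }
      ... | inj₁ refl with ins-o (proj₁ (∈-minus⁻ x∈) , xo)
      ...   | inj₁ refl = lift a≢e a≢d c≢e c≢d a<c
      ...   | inj₂ refl = lift b≢e b≢d c≢e c≢d b<c

      ranking′ : Σ (Ranking n) (Good W)
      ranking′ with insertAny (I₂.ρ , I₂.good , t , sep-o)
      ... | _ , _ , _ , I₃ = Inserted.ρ I₃ , Inserted.good I₃

  -- The induction on the number of vertices.

  solve-empty : ∀ {W} → (∀ {v} → ¬ v ∈ W) → Σ (Ranking n) (Good W)
  solve-empty empty = (λ _ _ → 0) , record
    { majority = λ u∈ → contradiction u∈ empty
    ; mixed    = λ u∈ → contradiction u∈ empty
    }

  -- A thin vertex is prepared in `W` itself, at the present size; the dense cases remove vertices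
  -- first and prepare in smaller sets.
  solve-step : ∀ {k} → Prepare k → Prepare (suc k) → Solve (suc k)
  solve-step prepare prepare′ {W} le with any? (λ v → (v ∈? W) ×-dec Thin? (W - v) v)
  ... | yes (v , v∈ , thin) with insertAny (prepare′ le v∈ thin)
  ...   | _ , _ , _ , I = Inserted.ρ I , Inserted.good I
  solve-step prepare prepare′ {W} le | no ¬thin with any? (_∈? W)
  ... | no empty = solve-empty λ v∈ → empty (_ , v∈)
  ... | yes (o , o∈) with Transitive? W
  ...   | yes (_ , _ , _ , t) = solve-transitive prepare le (thick⇒dense λ v∈ thin → ¬thin (_ , v∈ , thin)) t
  ...   | no ¬t = solve-intransitive prepare le (thick⇒dense λ v∈ thin → ¬thin (_ , v∈ , thin)) o∈
                    λ t → ¬t (_ , _ , _ , t)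

  solve&prepare : ∀ k → Solve k × Prepare k
  solve&prepare zero    = (λ le → solve-empty λ v∈ → size-zero v∈ le) , λ le v∈ → contradiction le (size-zero v∈)
  solve&prepare (suc k) =
    let solve , prepare = solve&prepare k
        prepare′ = prepare-step solve prepare
    in solve-step prepare prepare′ , prepare′

  goodRanking : Σ (Ranking n) (Good ⊤)
  goodRanking = proj₁ (solve&prepare ∣ ⊤ {n} ∣) ≤-refl

-- From orgraphs to neighbour lists, and from rankings to feedback arc sets.

fromOrgraph : ∀ {n m} (H : Orgraph n m) → MaxDegreeAtMost H 4 → Digraph n
fromOrgraph {n} {m} H Δ≤4 = record
  { In         = λ v → map tail (inArcs v)
  ; Out        = λ v → map head (outArcs v)
  ; In⇒Out     = In⇒Out
  ; Out⇒In     = Out⇒In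
  ; asym       = λ u⟶v v⟶u →
      let j , tj , hj = In⁻ u⟶v ; k , tk , hk = In⁻ v⟶u in
      no-2cyc H j k (trans tj (sym hk) , trans hj (sym tk))
  ; In-unique  = λ v → map-unique tail
      (λ x∈ y∈ e → arc-inj H (cong₂ _,_ e
        (trans (proj₂ (∈-filter⁻ (hasHead? v) {xs = allFin m} x∈))
          (sym (proj₂ (∈-filter⁻ (hasHead? v) {xs = allFin m} y∈))))))
      (Unique.filter⁺ (hasHead? v) (Unique.allFin⁺ m))
  ; Out-unique = λ v → map-unique head
      (λ x∈ y∈ e → arc-inj H (cong₂ _,_
        (trans (proj₂ (∈-filter⁻ (hasTail? v) {xs = allFin m} x∈))
          (sym (proj₂ (∈-filter⁻ (hasTail? v) {xs = allFin m} y∈)))) e))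
      (Unique.filter⁺ (hasTail? v) (Unique.allFin⁺ m))
  ; degree≤4   = λ v → ≤-trans (≤-reflexive (trans
      (cong₂ _+_ (length-map tail (inArcs v)) (length-map head (outArcs v)))
      (+-comm (indeg H v) (outdeg H v)))) (Δ≤4 v)
  }
  where
  tail head : Fin m → Fin n
  tail j = proj₁ (arc H j)
  head j = proj₂ (arc H j)
  hasHead? : ∀ v j → Dec (head j ≡ v)
  hasHead? v j = head j ≟ v
  hasTail? : ∀ v j → Dec (tail j ≡ v)
  hasTail? v j = tail j ≟ v
  inArcs outArcs : Fin n → List (Fin m)
  inArcs  v = filter (hasHead? v) (allFin m)
  outArcs v = filter (hasTail? v) (allFin m)

  In⁻ : ∀ {u v} → u ∈ˡ map tail (inArcs v) → Σ (Fin m) λ j → tail j ≡ u × head j ≡ v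
  In⁻ {v = v} u∈ with ∈-map∘filter⁻ tail (hasHead? v) {xs = allFin m} u∈
  ... | j , _ , u≡ , h = j , sym u≡ , h

  In⇒Out : ∀ {u v} → u ∈ˡ map tail (inArcs v) → v ∈ˡ map head (outArcs u)
  In⇒Out {u} u∈ = let j , t , h = In⁻ u∈ in
    ∈-map∘filter⁺ head (hasTail? u) (j , ∈-allFin j , sym h , t)

  Out⇒In : ∀ {u v} → v ∈ˡ map head (outArcs u) → u ∈ˡ map tail (inArcs v)
  Out⇒In {u} {v} v∈ with ∈-map∘filter⁻ head (hasTail? u) {xs = allFin m} v∈
  ... | j , _ , v≡ , t = ∈-map∘filter⁺ tail (hasHead? v) (j , ∈-allFin j , sym t , sym v≡)

-- Going round the cycle raises the rank at each step, so after `B` steps it is at least `B`, a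
-- strict bound on all ranks.
increasing⇒acyclic : ∀ {n m} (H : Orgraph n m) (S : Fin m → Set) (r : Fin n → ℕ) →
  (∀ j → S j → r (proj₁ (arc H j)) < r (proj₂ (arc H j))) → ¬ DirectedCycleIn H S
increasing⇒acyclic {n} H S r increasing (k , vs , _ , arcs) = <-irrefl refl (≤-<-trans (climb B) (bounded (∈-allFin _)))
  where
  bound = leastStrictUpperBound r (allFin n)
  B = proj₁ bound
  bounded = proj₁ (proj₂ bound)

  walk : ℕ → Fin (suc k)
  walk zero    = zero
  walk (suc t) = next (walk t)

  step : ∀ i → r (vs i) < r (vs (next i))
  step i = let j , Sj , e = arcs i in
    subst (λ p → r (proj₁ p) < r (proj₂ p)) e (increasing j Sj)

  climb : ∀ t → t ≤ r (vs (walk t))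
  climb zero    = z≤n
  climb (suc t) = ≤-<-trans (climb t) (step (walk t))

theorem1 : ∀ {n m} (H : Orgraph n m) → MaxDegreeAtMost H 4 → DirectedGirthAtLeast H 3 →
    Σ (Fin m → Fin 3) λ c → ∀ (i : Fin 3) → FeedbackArcSet H (λ j → c j ≡ i)
theorem1 {n} {m} H Δ≤4 _ =
  (λ j → proj₁ (colour j)) ,
  -- An arc not coloured `i` has its exception elsewhere, so it increases in ranking `i`.
  λ i → increasing⇒acyclic H _ (r i) λ j c≢i → proj₂ (colour j) i (c≢i ∘ sym)
  where
  open Construction (fromOrgraph H Δ≤4)
  r = proj₁ goodRanking
  colour : ∀ j → Σ (Fin 3) λ k₀ → ∀ k → k ≢ k₀ → r k (proj₁ (arc H j)) < r k (proj₂ (arc H j))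
  colour j = Good.majority (proj₂ goodRanking) ∈⊤ ∈⊤
    (∈-map∘filter⁺ (proj₁ ∘ arc H) (λ k → proj₂ (arc H k) ≟ proj₂ (arc H j)) (j , ∈-allFin j , refl , refl))
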